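{- Let $\mathcal L$ be a commutative residuated complete lattice. The following assertions are equivalent: (1) for all $f\in USC(\mathcal L)$, $2f=f\dot+f$; (2) $\mathcal L$ is a locale (i.e. $\otimes=\wedge$ on $\mathcal L$).
   Context: A commutative residuated complete lattice is a complete lattice $\mathcal L$ (least $\bot$, greatest $\top$) with a commutative associative operation $\otimes$ with neutral element $\top$ and an operation $\nrightarrow$ with $u\otimes v\le w\iff u\le v\nrightarrow w$. $USC(\mathcal L)$ is the set of maps $f:[0,1]\to\mathcal L$ preserving arbitrary suprema (so $f(0)=\bot$), ordered by $f\le g\iff g(q)\le f(q)$ for all $q\in[0,1]$. For $f,g\in USC(\mathcal L)$: $(2f)(q)=f(q/2)$ and $(f\dot+g)(q)=\bigvee\{f(p)\otimes g(r):p,r\in[0,1],\ p+r<q\}$. -}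

module Defs where

open import Algebra.Core using (Op₂)
open import Algebra.Structures using (IsCommutativeMonoid)
open import Data.Empty using (⊥-elim)
import Data.Integer as ℤ
import Data.Nat as ℕ
open import Data.Product using (_×_; _,_; proj₁; proj₂; ∃; ∃-syntax; Σ-syntax)
open import Data.Rational as ℚ using (ℚ; 0ℚ; 1ℚ; ½)
import Data.Rational.Properties as ℚₚ
open import Data.Sum using (_⊎_; inj₁; inj₂)
open import Function using (_∘_; flip; _⇔_)
open import Level using (Level; 0ℓ; suc; _⊔_)
open import Relation.Binary.Core using (Rel)
open import Relation.Binary.Definitions using (tri<; tri≈; tri>)
open import Relation.Binary.Lattice.Bundles using (BoundedLattice)
open import Relation.Binary.PropositionalEquality using (_≡_; refl; sym; trans; cong; subst)
open import Relation.Nullary using (yes; no)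
open import Relation.Unary using (Pred; _∈_; _∉_; _⊆′_)

private
  variable
    a c i ℓ ℓ₁ ℓ₂ ι : Level

IsSupremum : {A : Set a} → Rel A ℓ → {I : Set i} → (I → A) → A → Set _
IsSupremum _≤_ x s = (∀ i → x i ≤ s) × (∀ u → (∀ i → x i ≤ u) → s ≤ u)

IsInfimum : {A : Set a} → Rel A ℓ → {I : Set i} → (I → A) → A → Set _
IsInfimum _≤_ = IsSupremum (flip _≤_)

-- Completeness refers to families indexed by types in Set ι.  Predicatively ι
-- cannot be tied to the level of the carrier, and arbitrary infima do not
-- follow from arbitrary suprema, so both are required.
record CommutativeResiduatedCompleteLattice c ℓ₁ ℓ₂ ι
       : Set (suc (c ⊔ ℓ₁ ⊔ ℓ₂ ⊔ ι)) where
  infixr 7 _⊗_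
  infixr 5 _⊸_
  field
    boundedLattice : BoundedLattice c ℓ₁ ℓ₂

  open BoundedLattice boundedLattice public

  field
    ⋁           : {I : Set ι} → (I → Carrier) → Carrier
    ⋀           : {I : Set ι} → (I → Carrier) → Carrier
    ⋁-supremum  : {I : Set ι} (x : I → Carrier) → IsSupremum _≤_ x (⋁ x)
    ⋀-infimum   : {I : Set ι} (x : I → Carrier) → IsInfimum _≤_ x (⋀ x)
    _⊗_         : Op₂ Carrier
    _⊸_         : Op₂ Carrier
    ⊗-isCommutativeMonoid : IsCommutativeMonoid _≈_ _⊗_ ⊤
    residuated  : ∀ u v w → (u ⊗ v) ≤ w ⇔ u ≤ (v ⊸ w)

  IsLocale : Set _
  IsLocale = ∀ u v → (u ⊗ v) ≈ (u ∧ v)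

-- Real numbers as Dedekind cuts, each represented by its lower set: a nonempty
-- proper down-closed set of rationals without a greatest element.  Membership
-- need not be decidable, so that bounded families of reals have suprema,
-- namely unions, without excluded middle.  Read constructively these are the
-- lower reals; classically they are the real numbers.
record ℝ : Set₁ where
  field
    cut       : Pred ℚ 0ℓ
    inhabited : ∃ λ a → a ∈ cut
    proper    : ∃ λ a → a ∉ cut
    downward  : ∀ {a b} → a ℚ.< b → b ∈ cut → a ∈ cut
    rounded   : ∀ {a} → a ∈ cut → ∃ λ b → a ℚ.< b × b ∈ cut

open ℝ public

infix 4 _≤ʳ_ _<ʳ_
infixl 6 _+ʳ_

_≤ʳ_ : Rel ℝ 0ℓ
x ≤ʳ y = cut x ⊆′ cut y

-- Classically, proper inclusion of lower sets.
_<ʳ_ : Rel ℝ 0ℓ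
x <ʳ y = ∃ λ a → a ∈ cut y × a ∉ cut x

∉⇒> : ∀ (x : ℝ) {a b} → a ∉ cut x → b ∈ cut x → b ℚ.< a
∉⇒> x {a} {b} a∉x b∈x with b ℚₚ.<? a
... | yes b<a = b<a
... | no  b≮a with ℚₚ.<-cmp a b
...   | tri< a<b _ _ = ⊥-elim (a∉x (downward x a<b b∈x))
...   | tri≈ _ refl _ = ⊥-elim (a∉x b∈x)
...   | tri> _ _ b<a = b<a

½c+½c≡c : ∀ c → ½ ℚ.* c ℚ.+ ½ ℚ.* c ≡ c
½c+½c≡c c = trans (sym (ℚₚ.*-distribʳ-+ c ½ ½)) (ℚₚ.*-identityˡ c)

a+a<c⇒a<½c : ∀ {a c} → a ℚ.+ a ℚ.< c → a ℚ.< ½ ℚ.* c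
a+a<c⇒a<½c {a} {c} a+a<c with a ℚₚ.<? ½ ℚ.* c
... | yes a<½c = a<½c
... | no  a≮½c = ⊥-elim (ℚₚ.<-irrefl refl (ℚₚ.<-≤-trans a+a<c c≤a+a))
  where
  ½c≤a  = ℚₚ.≮⇒≥ a≮½c
  c≤a+a = subst (ℚ._≤ a ℚ.+ a) (½c+½c≡c c) (ℚₚ.+-mono-≤ ½c≤a ½c≤a)

a≡b+[a-b] : ∀ a b → a ≡ b ℚ.+ (a ℚ.- b)
a≡b+[a-b] a b = sym (trans (ℚₚ.+-comm b (a ℚ.- b))
  (trans (ℚₚ.+-assoc a (ℚ.- b) b)
  (trans (cong (a ℚ.+_) (ℚₚ.+-inverseˡ b)) (ℚₚ.+-identityʳ a))))

a<b+c⇒a-b<c : ∀ {a b c} → a ℚ.< b ℚ.+ c → a ℚ.- b ℚ.< c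
a<b+c⇒a-b<c {a} {b} {c} a<b+c = subst (a ℚ.- b ℚ.<_) eq
  (ℚₚ.+-monoˡ-< (ℚ.- b) a<b+c)
  where
  eq : b ℚ.+ c ℚ.- b ≡ c
  eq = trans (cong (ℚ._- b) (ℚₚ.+-comm b c))
    (trans (ℚₚ.+-assoc c b (ℚ.- b))
    (trans (cong (c ℚ.+_) (ℚₚ.+-inverseʳ b)) (ℚₚ.+-identityʳ c)))

fromℚ : ℚ → ℝ
fromℚ r .cut a     = a ℚ.< r
fromℚ r .inhabited = r ℚ.- 1ℚ , subst (r ℚ.- 1ℚ ℚ.<_) (ℚₚ.+-identityʳ r)
  (ℚₚ.+-monoʳ-< r (ℚₚ.negative⁻¹ (ℚ.- 1ℚ)))
fromℚ r .proper    = r , ℚₚ.<-irrefl refl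
fromℚ r .downward  = ℚₚ.<-trans
fromℚ r .rounded   = ℚₚ.<-dense

_+ʳ_ : ℝ → ℝ → ℝ
(x +ʳ y) .cut a = ∃[ b ] ∃[ c ] b ∈ cut x × c ∈ cut y × a ≡ b ℚ.+ c
(x +ʳ y) .inhabited =
  let b , b∈x = inhabited x ; c , c∈y = inhabited y
  in  b ℚ.+ c , b , c , b∈x , c∈y , refl
(x +ʳ y) .proper =
  let b , b∉x = proper x ; c , c∉y = proper y
  in  b ℚ.+ c , λ (b′ , c′ , b′∈x , c′∈y , eq) →
        ℚₚ.<-irrefl (sym eq) (ℚₚ.+-mono-< (∉⇒> x b∉x b′∈x) (∉⇒> y c∉y c′∈y))
(x +ʳ y) .downward {a} a<s (b , c , b∈x , c∈y , refl) =
  b , a ℚ.- b , b∈x , downward y (a<b+c⇒a-b<c a<s) c∈y , a≡b+[a-b] a b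
(x +ʳ y) .rounded (b , c , b∈x , c∈y , refl) =
  let c′ , c<c′ , c′∈y = rounded y c∈y
  in  b ℚ.+ c′ , ℚₚ.+-monoʳ-< b c<c′ , b , c′ , b∈x , c′∈y , refl

_/2 : ℝ → ℝ
(x /2) .cut a = a ℚ.+ a ∈ cut x
(x /2) .inhabited =
  let c , c∈x = inhabited x in ½ ℚ.* c , subst (_∈ cut x) (sym (½c+½c≡c c)) c∈x
(x /2) .proper =
  let c , c∉x = proper x in ½ ℚ.* c , c∉x ∘ subst (_∈ cut x) (½c+½c≡c c)
(x /2) .downward a<b = downward x (ℚₚ.+-mono-< a<b a<b)
(x /2) .rounded a+a∈x =
  let c , a+a<c , c∈x = rounded x a+a∈x
  in  ½ ℚ.* c , a+a<c⇒a<½c a+a<c , subst (_∈ cut x) (sym (½c+½c≡c c)) c∈x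

0ʳ 1ʳ : ℝ
0ʳ = fromℚ 0ℚ
1ʳ = fromℚ 1ℚ

record [0,1] : Set₁ where
  constructor interval
  field
    real : ℝ
    0≤   : 0ʳ ≤ʳ real
    ≤1   : real ≤ʳ 1ʳ

open [0,1] public using (real)

infix 4 _≤ⁱ_

_≤ⁱ_ : Rel [0,1] 0ℓ
p ≤ⁱ q = real p ≤ʳ real q

half : [0,1] → [0,1]
half (interval x 0≤x x≤1) = interval (x /2) 0≤x/2 x/2≤1
  where
  0≤x/2 : 0ʳ ≤ʳ x /2
  0≤x/2 a a<0 = 0≤x (a ℚ.+ a) (ℚₚ.+-mono-< a<0 a<0)

  x/2≤1 : x /2 ≤ʳ 1ʳ
  x/2≤1 a a+a∈x =
    ℚₚ.<-trans (a+a<c⇒a<½c (x≤1 (a ℚ.+ a) a+a∈x)) (ℚ.*<* (ℤ.+<+ (ℕ.s≤s (ℕ.s≤s ℕ.z≤n))))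

⋃ : {I : Set} → (I → [0,1]) → [0,1]
⋃ {I} p = interval union (λ _ → inj₁) union≤1
  where
  union : ℝ
  union .cut a     = a ℚ.< 0ℚ ⊎ ∃ λ i → a ∈ cut (real (p i))
  union .inhabited = let a , a<0 = inhabited 0ʳ in a , inj₁ a<0
  union .proper    = 1ℚ , λ where
    (inj₁ 1<0)       → ℚₚ.<-asym 1<0 (ℚₚ.positive⁻¹ 1ℚ)
    (inj₂ (i , 1∈p)) → ℚₚ.<-irrefl refl ([0,1].≤1 (p i) 1ℚ 1∈p)
  union .downward a<b (inj₁ b<0)       = inj₁ (ℚₚ.<-trans a<b b<0)
  union .downward a<b (inj₂ (i , b∈p)) = inj₂ (i , downward (real (p i)) a<b b∈p)
  union .rounded (inj₁ a<0) = let b , a<b , b<0 = ℚₚ.<-dense a<0 in b , a<b , inj₁ b<0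
  union .rounded (inj₂ (i , a∈p)) =
    let b , a<b , b∈p = rounded (real (p i)) a∈p in b , a<b , inj₂ (i , b∈p)

  union≤1 : union ≤ʳ 1ʳ
  union≤1 a (inj₁ a<0)       = ℚₚ.<-trans a<0 (ℚₚ.positive⁻¹ 1ℚ)
  union≤1 a (inj₂ (i , a∈p)) = [0,1].≤1 (p i) a a∈p

sup≤⋃ : {I : Set} (p : I → [0,1]) (s : [0,1]) → IsSupremum _≤ⁱ_ p s → s ≤ⁱ ⋃ p
sup≤⋃ p s (_ , least) = least (⋃ p) (λ i a a∈p → inj₂ (i , a∈p))

-- Completeness of 𝓛 is needed at level 1 because [0,1] is a type in Set₁.
module _ (𝓛 : CommutativeResiduatedCompleteLattice c ℓ₁ ℓ₂ (suc 0ℓ)) where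
  open CommutativeResiduatedCompleteLattice 𝓛

  -- Set is the level at which [0,1] is complete.  A singleton family shows that
  -- preserving suprema includes respecting equality of reals.
  record USC : Set (suc 0ℓ ⊔ c ⊔ ℓ₂) where
    field
      fun         : [0,1] → Carrier
      preserves-⋁ : {I : Set} (p : I → [0,1]) (s : [0,1]) →
                    IsSupremum _≤ⁱ_ p s → IsSupremum _≤_ (fun ∘ p) (fun s)

module _ {𝓛 : CommutativeResiduatedCompleteLattice c ℓ₁ ℓ₂ (suc 0ℓ)} where
  open CommutativeResiduatedCompleteLattice 𝓛
  open USC

  infix  4 _≈ᵘ_
  infixl 6 _∔_

  _≈ᵘ_ : Rel (USC 𝓛) _
  f ≈ᵘ g = ∀ q → fun f q ≈ fun g q

  twice : USC 𝓛 → USC 𝓛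
  twice f .fun q = fun f (half q)
  twice f .preserves-⋁ p s sup = preserves-⋁ f (half ∘ p) (half s) (upper , least)
    where
    upper : ∀ i → half (p i) ≤ⁱ half s
    upper i a = proj₁ sup i (a ℚ.+ a)

    least : ∀ u → (∀ i → half (p i) ≤ⁱ u) → half s ≤ⁱ u
    least u p/2≤u a a+a∈s with sup≤⋃ p s sup (a ℚ.+ a) a+a∈s
    ... | inj₁ a+a<0       = [0,1].0≤ u a (a+a<c⇒a<½c a+a<0)
    ... | inj₂ (i , a+a∈p) = p/2≤u i a a+a∈p

  _∔_ : USC 𝓛 → USC 𝓛 → USC 𝓛
  (f ∔ g) .fun q =
    ⋁ {I = Σ[ p ∈ [0,1] ] Σ[ r ∈ [0,1] ] real p +ʳ real r <ʳ real q}
      (λ (p , r , _) → fun f p ⊗ fun g r)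
  (f ∔ g) .preserves-⋁ x s sup = upper , least
    where
    upper : ∀ i → fun (f ∔ g) (x i) ≤ fun (f ∔ g) s
    upper i = proj₂ (⋁-supremum _) _ λ (p , r , a , a∈x , a∉p+r) →
      proj₁ (⋁-supremum _) (p , r , a , proj₁ sup i a a∈x , a∉p+r)

    least : ∀ u → (∀ i → fun (f ∔ g) (x i) ≤ u) → fun (f ∔ g) s ≤ u
    least u ≤u = proj₂ (⋁-supremum _) u bound
      where
      bound : ((p , r , _) : Σ[ p ∈ [0,1] ] Σ[ r ∈ [0,1] ] real p +ʳ real r <ʳ real s) →
              (fun f p ⊗ fun g r) ≤ u
      bound (p , r , a , a∈s , a∉p+r) with sup≤⋃ x s sup a a∈s
      ... | inj₂ (i , a∈x) =
        BoundedLattice.trans boundedLattice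
          (proj₁ (⋁-supremum _) (p , r , a , a∈x , a∉p+r)) (≤u i)
      ... | inj₁ a<0 = ⊥-elim (a∉p+r (½ ℚ.* a , ½ ℚ.* a , ½a∈ p , ½a∈ r , sym (½c+½c≡c a)))
        where
        ½a<0 : ½ ℚ.* a ℚ.< 0ℚ
        ½a<0 = a+a<c⇒a<½c (subst (ℚ._< 0ℚ) (sym (½c+½c≡c a)) a<0)

        ½a∈ : ∀ t → ½ ℚ.* a ∈ cut (real t)
        ½a∈ t = [0,1].0≤ t (½ ℚ.* a) ½a<0

{-# OPTIONS --safe #-}

-- If ⊗ is the meet, then f preserving suprema and ⊗ distributing over them
-- reduce everything to rational points: of two rationals b, c with b + c < q
-- the smaller is below q/2, and conversely f(b) = f(b) ⊗ f(b).  Restricting to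
-- rationals is what makes the choice of the smaller one constructive.
-- Conversely, for the map f that is u on (0,1] and ⊥ at 0, comparing 2f and
-- f ∔ f at 1 yields u ≤ u ⊗ u; as ⊤ is neutral for ⊗, idempotence of ⊗ forces
-- it to be the meet.
module Submission where

open import Algebra.Structures using (IsCommutativeMonoid)
open import Data.Bool using (true; false; if_then_else_)
open import Data.Empty using (⊥-elim)
open import Data.Product using (_×_; _,_; proj₁; proj₂; Σ-syntax)
open import Data.Rational as ℚ using (ℚ; 0ℚ; 1ℚ)
import Data.Rational.Properties as ℚₚ
open import Data.Sum using (inj₁; inj₂)
open import Defs
open import Function using (_⇔_; mk⇔; Equivalence)
open import Level using (Level; Lift; lift; 0ℓ; suc)
open import Relation.Binary.PropositionalEquality using (refl; sym)
open import Relation.Nullary using (yes; no)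
open import Relation.Unary using (_∈_; _∉_)

-- This index type lies in `Set`, whereas `[0,1]` lies in `Set₁`, so `preserves-⋁` applies to
-- families over it. It is empty at the point 0.
NonNegativeRationalBelow : [0,1] → Set
NonNegativeRationalBelow x = Σ[ b ∈ ℚ ] 0ℚ ℚ.≤ b × b ∈ cut (real x)

rationalPoint : (x : [0,1]) → NonNegativeRationalBelow x → [0,1]
rationalPoint x (b , 0≤b , b∈x) = interval (fromℚ b)
  (λ a a<0 → ℚₚ.<-≤-trans a<0 0≤b)
  (λ a a<b → ℚₚ.<-trans a<b ([0,1].≤1 x b b∈x))

rationalPoint-supremum : ∀ x → IsSupremum _≤ⁱ_ (rationalPoint x) x
rationalPoint-supremum x = upper , least
  where
  upper : ∀ i → rationalPoint x i ≤ⁱ x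
  upper (b , _ , b∈x) a a<b = downward (real x) a<b b∈x

  least : ∀ u → (∀ i → rationalPoint x i ≤ⁱ u) → x ≤ⁱ u
  least u below a a∈x with rounded (real x) a∈x
  ... | b , a<b , b∈x with 0ℚ ℚₚ.≤? b
  ...   | yes 0≤b = below (b , 0≤b , b∈x) a a<b
  -- A negative `b` indexes no point, but then `a` is negative and lies in every cut of `[0,1]`.
  ...   | no  0≰b = [0,1].0≤ u a (ℚₚ.<-trans a<b (ℚₚ.≰⇒> 0≰b))

∉+ʳ⇒+< : ∀ (x y : ℝ) {a b c} → a ∉ cut (x +ʳ y) → b ∈ cut x → c ∈ cut y → b ℚ.+ c ℚ.< a
∉+ʳ⇒+< x y {a} {b} {c} a∉x+y b∈x c∈y = ∉⇒> (x +ʳ y) a∉x+y (b , c , b∈x , c∈y , refl)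

b+b∉fromℚb+ʳfromℚb : ∀ b → b ℚ.+ b ∉ cut (fromℚ b +ʳ fromℚ b)
b+b∉fromℚb+ʳfromℚb b (c , d , c<b , d<b , eq) =
  ℚₚ.<-irrefl (sym eq) (ℚₚ.+-mono-< c<b d<b)

fromℚ≤half : ∀ {a b} (q : [0,1]) → b ℚ.+ b ℚ.≤ a → a ∈ cut (real q) →
             fromℚ b ≤ʳ real (half q)
fromℚ≤half q b+b≤a a∈q d d<b =
  downward (real q) (ℚₚ.<-≤-trans (ℚₚ.+-mono-< d<b d<b) b+b≤a) a∈q

1ⁱ : [0,1]
1ⁱ = interval 1ʳ (λ a a<0 → ℚₚ.<-trans a<0 (ℚₚ.positive⁻¹ 1ℚ)) (λ _ a<1 → a<1)

module _ {c ℓ₁ ℓ₂ ι : Level} (𝓛 : CommutativeResiduatedCompleteLattice c ℓ₁ ℓ₂ ι) where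
  open CommutativeResiduatedCompleteLattice 𝓛 renaming (refl to ≤-refl; trans to ≤-trans)
  open IsCommutativeMonoid ⊗-isCommutativeMonoid using (comm; identityʳ)

  ⊗-comm-≤ : ∀ u v → (u ⊗ v) ≤ (v ⊗ u)
  ⊗-comm-≤ u v = reflexive (comm u v)

  ⊗-monoˡ : ∀ {u u′} v → u ≤ u′ → (u ⊗ v) ≤ (u′ ⊗ v)
  ⊗-monoˡ {u} {u′} v u≤u′ = from (≤-trans u≤u′ (to′ ≤-refl))
    where
    open Equivalence (residuated u v (u′ ⊗ v)) using (from)
    open Equivalence (residuated u′ v (u′ ⊗ v)) using () renaming (to to to′)

  ⊗-mono : ∀ {u u′ v v′} → u ≤ u′ → v ≤ v′ → (u ⊗ v) ≤ (u′ ⊗ v′)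
  ⊗-mono {u} {u′} {v} {v′} u≤u′ v≤v′ =
    ≤-trans (⊗-monoˡ v u≤u′)
      (≤-trans (⊗-comm-≤ u′ v) (≤-trans (⊗-monoˡ u′ v≤v′) (⊗-comm-≤ v′ u′)))

  ⊗≤left : ∀ u v → (u ⊗ v) ≤ u
  ⊗≤left u v = ≤-trans (⊗-mono ≤-refl (maximum v)) (reflexive (identityʳ u))

  ⊗≤∧ : ∀ u v → (u ⊗ v) ≤ (u ∧ v)
  ⊗≤∧ u v = ∧-greatest (⊗≤left u v) (≤-trans (⊗-comm-≤ u v) (⊗≤left v u))

  -- By residuation, tensoring with `v` is a left adjoint, so it preserves suprema.
  ⊗-supremumˡ-≤ : ∀ {i} {I : Set i} {x : I → Carrier} {s} v {w} → IsSupremum _≤_ x s →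
                  (∀ j → (x j ⊗ v) ≤ w) → (s ⊗ v) ≤ w
  ⊗-supremumˡ-≤ {x = x} {s} v {w} (_ , least) x⊗v≤w =
    Equivalence.from (residuated s v w)
      (least (v ⊸ w) λ j → Equivalence.to (residuated (x j) v w) (x⊗v≤w j))

  ⊗-supremum-≤ : ∀ {i j} {I : Set i} {J : Set j} {x : I → Carrier} {y : J → Carrier}
                 {s t w} → IsSupremum _≤_ x s → IsSupremum _≤_ y t →
                 (∀ i j → (x i ⊗ y j) ≤ w) → (s ⊗ t) ≤ w
  ⊗-supremum-≤ {x = x} {y} {t = t} supₓ supᵧ x⊗y≤w =
    ⊗-supremumˡ-≤ t supₓ λ i →
      ≤-trans (⊗-comm-≤ (x i) t)
        (⊗-supremumˡ-≤ (x i) supᵧ λ j →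
          ≤-trans (⊗-comm-≤ (y j) (x i)) (x⊗y≤w i j))

  ⊗-idempotent⇒locale : (∀ u → u ≤ (u ⊗ u)) → IsLocale
  ⊗-idempotent⇒locale idem u v = antisym (⊗≤∧ u v)
    (≤-trans (idem (u ∧ v)) (⊗-mono (x∧y≤x u v) (x∧y≤y u v)))

module _ {c ℓ₁ ℓ₂ : Level} (𝓛 : CommutativeResiduatedCompleteLattice c ℓ₁ ℓ₂ (suc 0ℓ)) where
  open CommutativeResiduatedCompleteLattice 𝓛 renaming (refl to ≤-refl; trans to ≤-trans)
  open USC

  -- If `p ≤ⁱ q`, the two-element family `p`, `q` has supremum `q`, which `f` preserves.
  fun-mono : (f : USC 𝓛) → ∀ {p q} → p ≤ⁱ q → fun f p ≤ fun f q
  fun-mono f {p} {q} p≤q = proj₁ (preserves-⋁ f (λ b → if b then p else q) q (upper , least)) true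
    where
    upper : ∀ b → (if b then p else q) ≤ⁱ q
    upper true      = p≤q
    upper false a z = z

    least : ∀ u → (∀ b → (if b then p else q) ≤ⁱ u) → q ≤ⁱ u
    least u ≤u = ≤u false

  locale⇒twice≈∔ : IsLocale → (f : USC 𝓛) → twice f ≈ᵘ f ∔ f
  locale⇒twice≈∔ locale f q = antisym twice≤∔ ∔≤twice
    where
    fun-rationalPoint-supremum : ∀ x → IsSupremum _≤_ _ (fun f x)
    fun-rationalPoint-supremum x =
      preserves-⋁ f (rationalPoint x) x (rationalPoint-supremum x)

    idem : ∀ u → u ≤ (u ⊗ u)
    idem u = ≤-trans (∧-greatest ≤-refl ≤-refl) (reflexive (Eq.sym (locale u u)))

    twice≤∔ : fun (twice f) q ≤ fun (f ∔ f) q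
    twice≤∔ = proj₂ (fun-rationalPoint-supremum (half q)) _ λ i@(b , _ , b+b∈q) → ≤-trans (idem _)
        (proj₁ (⋁-supremum _)
          (rationalPoint (half q) i , rationalPoint (half q) i
          -- `b + b` witnesses the strict inequality: membership of `b` in `half q` is by definition
          -- membership of `b + b` in `q`.
          , b ℚ.+ b , b+b∈q , b+b∉fromℚb+ʳfromℚb b))

    ∔≤twice : fun (f ∔ f) q ≤ fun (twice f) q
    ∔≤twice = proj₂ (⋁-supremum _) _ λ (p , r , a , a∈q , a∉p+r) →
      ⊗-supremum-≤ 𝓛 (fun-rationalPoint-supremum p) (fun-rationalPoint-supremum r)
        (bound p r a a∈q a∉p+r)
      where
      bound : ∀ p r a → a ∈ cut (real q) → a ∉ cut (real p +ʳ real r) →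
              ∀ i j → (fun f (rationalPoint p i) ⊗ fun f (rationalPoint r j)) ≤ fun f (half q)
      bound p r a a∈q a∉p+r i@(b , _ , b∈p) j@(c , _ , c∈r) with ℚₚ.≤-total b c
      -- The factor at the larger rational is dropped; the smaller one satisfies `b + b ≤ b + c < a`
      -- with `a` in the cut of `q`.
      ... | inj₁ b≤c = ≤-trans (⊗≤left 𝓛 _ _)
        (fun-mono f {rationalPoint p i} (fromℚ≤half q b+b≤a a∈q))
        where
        b+c<a = ∉+ʳ⇒+< (real p) (real r) a∉p+r b∈p c∈r
        b+b≤a = ℚₚ.≤-trans (ℚₚ.+-monoʳ-≤ b b≤c) (ℚₚ.<⇒≤ b+c<a)
      ... | inj₂ c≤b = ≤-trans (⊗-comm-≤ 𝓛 _ _) (≤-trans (⊗≤left 𝓛 _ _)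
        (fun-mono f {rationalPoint r j} (fromℚ≤half q c+c≤a a∈q)))
        where
        b+c<a = ∉+ʳ⇒+< (real p) (real r) a∉p+r b∈p c∈r
        c+c≤a = ℚₚ.≤-trans (ℚₚ.+-monoˡ-≤ c c≤b) (ℚₚ.<⇒≤ b+c<a)

  -- A supremum over the proof-relevant condition "0 is in the cut" avoids deciding whether `q` is
  -- positive; over no proofs it is the least element. `Lift` moves the condition to the level at
  -- which `⋁` is given.
  step : Carrier → USC 𝓛
  step u .fun q = ⋁ {I = Lift (suc 0ℓ) (0ℚ ∈ cut (real q))} (λ _ → u)
  step u .preserves-⋁ p s sup = upper , least
    where
    upper : ∀ i → fun (step u) (p i) ≤ fun (step u) s
    upper i = proj₂ (⋁-supremum _) _ λ (lift 0∈p) →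
      proj₁ (⋁-supremum _) (lift (proj₁ sup i 0ℚ 0∈p))

    least : ∀ v → (∀ i → fun (step u) (p i) ≤ v) → fun (step u) s ≤ v
    least v ≤v = proj₂ (⋁-supremum _) v bound
      where
      bound : Lift (suc 0ℓ) (0ℚ ∈ cut (real s)) → u ≤ v
      bound (lift 0∈s) with sup≤⋃ p s sup 0ℚ 0∈s
      ... | inj₁ 0<0       = ⊥-elim (ℚₚ.<-irrefl refl 0<0)
      ... | inj₂ (i , 0∈p) = ≤-trans (proj₁ (⋁-supremum _) (lift 0∈p)) (≤v i)

  step≤ : ∀ u q → fun (step u) q ≤ u
  step≤ u q = proj₂ (⋁-supremum _) u λ _ → ≤-refl

  twice≈∔⇒⊗-idempotent : ((f : USC 𝓛) → twice f ≈ᵘ f ∔ f) → ∀ u → u ≤ (u ⊗ u)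
  twice≈∔⇒⊗-idempotent twice≈∔ u =
    -- The condition for `step u` at `half 1ⁱ` is `0ℚ + 0ℚ < 1ℚ`, which computes to `0ℚ < 1ℚ`; hence
    -- `u` lies below the value there.
    ≤-trans (proj₁ (⋁-supremum _) (lift (ℚₚ.positive⁻¹ 1ℚ)))
      (≤-trans (reflexive (twice≈∔ (step u) 1ⁱ))
        (proj₂ (⋁-supremum _) (u ⊗ u) λ (p , r , _) →
          ⊗-mono 𝓛 (step≤ u p) (step≤ u r)))

corollary5p2p4 : {c ℓ₁ ℓ₂ : Level} (𝓛 : CommutativeResiduatedCompleteLattice c ℓ₁ ℓ₂ (suc 0ℓ)) →
    ((f : USC 𝓛) → twice f ≈ᵘ f ∔ f) ⇔ CommutativeResiduatedCompleteLattice.IsLocale 𝓛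
corollary5p2p4 𝓛 = mk⇔
  (λ twice≈∔ → ⊗-idempotent⇒locale 𝓛 (twice≈∔⇒⊗-idempotent 𝓛 twice≈∔))
  (locale⇒twice≈∔ 𝓛)
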